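{- Let $G$ be a finite simple undirected graph with bandwidth $b$. Then $\mathrm{cub}(G)\le b+1$, where $\mathrm{cub}(G)$ denotes the cubicity of $G$.
   Context: All graphs are simple, finite and undirected. Cubicity: a $k$-cube is a Cartesian product $R_1\times\cdots\times R_k$ where each $R_i$ is a closed interval of the form $[a_i,a_i+1]$ on the real line. The cubicity $\mathrm{cub}(G)$ is the minimum $k$ such that each vertex of $G$ can be mapped to a $k$-cube so that two distinct vertices are adjacent in $G$ if and only if their $k$-cubes have non-empty intersection. Bandwidth: for a graph $G=(V,E)$ on $n$ vertices, a linear ordering of $G$ is a bijection $f:V\to\{1,\ldots,n\}$; its width is $\max_{(u,v)\in E}|f(u)-f(v)|$ (taken to be $0$ if $E=\emptyset$). The bandwidth of $G$ is the minimum width over all linear orderings of $G$. -}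

module Defs where

open import Level using (0ℓ)
open import Data.Empty using (⊥)
open import Data.Fin.Base using (Fin; toℕ)
open import Data.List.Base using (List; allFin; cartesianProduct; filter; map)
open import Data.List.Extrema.Nat using (max)
open import Data.Nat.Base as ℕ using (ℕ; ∣_-_∣)
open import Data.Product.Base using (∃; _×_; _,_; uncurry)
open import Data.Rational.Base using (ℚ; 1ℚ; _+_; _-_; -_; _<_)
open import Data.Rational.Properties
  using (+-assoc; +-identityʳ; +-inverseʳ; +-monoˡ-<)
open import Data.Sum.Base using (_⊎_)
open import Data.Vec.Functional using (Vector)
open import Function.Bundles using (_↔_; _⤖_; _⇔_; module Inverse; module Bijection)
open import Relation.Binary.Core using (Rel)
open import Relation.Binary.Definitions using (Decidable; Irreflexive; Symmetric)
open import Relation.Binary.PropositionalEquality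
  using (_≡_; _≢_; sym; trans; cong; subst)

IsLeast : ∀ {ℓ} → (ℕ → Set ℓ) → ℕ → Set ℓ
IsLeast P m = P m × (∀ k → P k → m ℕ.≤ k)

-- Dedekind reals: two-sided cuts of ℚ.
record ℝ : Set₁ where
  field
    Lower Upper     : ℚ → Set
    lower-inhabited : ∃ Lower
    upper-inhabited : ∃ Upper
    lower-closed    : ∀ {p q} → p < q → Lower q → Lower p
    upper-closed    : ∀ {p q} → p < q → Upper p → Upper q
    lower-open      : ∀ {p} → Lower p → ∃ λ q → p < q × Lower q
    upper-open      : ∀ {q} → Upper q → ∃ λ p → p < q × Upper p
    disjoint        : ∀ {q} → Lower q → Upper q → ⊥
    located         : ∀ {p q} → p < q → Lower p ⊎ Upper q

open ℝ

infix 4 _≤ℝ_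
_≤ℝ_ : Rel ℝ 0ℓ
x ≤ℝ y = ∀ q → Lower x q → Lower y q

private
  p+1-1≡p : ∀ p → (p + 1ℚ) - 1ℚ ≡ p
  p+1-1≡p p = trans (+-assoc p 1ℚ (- 1ℚ))
                    (trans (cong (p +_) (+-inverseʳ 1ℚ)) (+-identityʳ p))

  p-1+1≡p : ∀ p → (p - 1ℚ) + 1ℚ ≡ p
  p-1+1≡p p = trans (+-assoc p (- 1ℚ) 1ℚ) (+-identityʳ p)

  -1-mono : ∀ {p q} → p < q → p - 1ℚ < q - 1ℚ
  -1-mono = +-monoˡ-< (- 1ℚ)

-- q < x + 1 iff q - 1 < x, and likewise for the upper cut.
infix 7 _+1
_+1 : ℝ → ℝ
x +1 = record
  { Lower           = λ q → Lower x (q - 1ℚ)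
  ; Upper           = λ q → Upper x (q - 1ℚ)
  ; lower-inhabited = let q , Lq = lower-inhabited x in
                      q + 1ℚ , subst (Lower x) (sym (p+1-1≡p q)) Lq
  ; upper-inhabited = let q , Uq = upper-inhabited x in
                      q + 1ℚ , subst (Upper x) (sym (p+1-1≡p q)) Uq
  ; lower-closed    = λ p<q → lower-closed x (-1-mono p<q)
  ; upper-closed    = λ p<q → upper-closed x (-1-mono p<q)
  ; lower-open      = λ {p} Lp → let q , p-1<q , Lq = lower-open x Lp in
                      q + 1ℚ
                      , subst (_< q + 1ℚ) (p-1+1≡p p) (+-monoˡ-< 1ℚ p-1<q)
                      , subst (Lower x) (sym (p+1-1≡p q)) Lq
  ; upper-open      = λ {q} Uq → let p , p<q-1 , Up = upper-open x Uq in
                      p + 1ℚ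
                      , subst (p + 1ℚ <_) (p-1+1≡p q) (+-monoˡ-< 1ℚ p<q-1)
                      , subst (Upper x) (sym (p+1-1≡p p)) Up
  ; disjoint        = disjoint x
  ; located         = λ p<q → located x (-1-mono p<q)
  }

record Graph : Set₁ where
  field
    Vertex : Set
    order  : ℕ
    finite : Vertex ↔ Fin order
    Adj    : Rel Vertex 0ℓ
    adj?   : Decidable Adj
    irrefl : Irreflexive _≡_ Adj
    symm   : Symmetric Adj

  vertices : List Vertex
  vertices = map (Inverse.from finite) (allFin order)

  -- Each edge is listed in both directions.
  edges : List (Vertex × Vertex)
  edges = filter (uncurry adj?) (cartesianProduct vertices vertices)

-- A k-cube is given by the left endpoints aᵢ of its sides [aᵢ , aᵢ + 1].
Cube : ℕ → Set₁
Cube k = Vector ℝ k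

infix 4 _∈_
_∈_ : ∀ {k} → Vector ℝ k → Cube k → Set
x ∈ a = ∀ i → a i ≤ℝ x i × x i ≤ℝ a i +1

Intersect : ∀ {k} → Cube k → Cube k → Set₁
Intersect {k} C D = ∃ λ (x : Vector ℝ k) → x ∈ C × x ∈ D

module _ (G : Graph) where
  open Graph G

  CubeRepresentable : ℕ → Set₁
  CubeRepresentable k = ∃ λ (cube : Vertex → Cube k) →
    ∀ u v → u ≢ v → Adj u v ⇔ Intersect (cube u) (cube v)

  IsCubicity : ℕ → Set₁
  IsCubicity = IsLeast CubeRepresentable

  -- Positions run over 0, …, n - 1 instead of 1, …, n; only their differences
  -- are used.
  LinearOrdering : Set
  LinearOrdering = Vertex ⤖ Fin order

  width : LinearOrdering → ℕ
  width f = max 0 (map (λ (u , v) → ∣ position u - position v ∣) edges)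
    where
    position : Vertex → ℕ
    position v = toℕ (Bijection.to f v)

  IsBandwidth : ℕ → Set
  IsBandwidth = IsLeast (λ w → ∃ λ f → width f ≡ w)

{-# OPTIONS --safe #-}
module Submission where

-- Order the vertices with width b and use b + 1 coordinates.  The coordinate
-- "position", in units of b + 1/2, separates all pairs at distance more than b.
-- There remain the non-adjacent pairs at distance at most b; there is one
-- coordinate for each residue class modulo b, which separates those pairs whose
-- left member lies in the class.  Call the positions of the class centres; each
-- centre starts a block of b positions.  In half units, such a coordinate has a
-- value c and a direction s = ±1 for each block: the centre is put at c, the
-- other vertices of the block at c + 2s or c + 3s according to whether or not
-- they are adjacent to the centre.  The next block has value c + s and direction
-- s if its centre is adjacent to the present one, and c + 4s and -s otherwise.
-- Then a pair at distance at most b is separated if its left member is a centre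
-- not adjacent to the right member, and only then.

open import Defs
open import Data.Fin.Base using (Fin; zero; suc; toℕ; fromℕ<; opposite)
open import Data.Fin.Properties using (nonZeroIndex; opposite-prop; toℕ-fromℕ<; toℕ-injective)
open import Data.Integer.Base as ℤ using (ℤ; +_)
import Data.Integer.Properties as ℤ
open import Data.Integer.Tactic.RingSolver using (solve-∀)
open import Data.List.Base using (cartesianProduct)
open import Data.List.Extrema.Nat using (xs≤max)
open import Data.List.Membership.Propositional using (lose; find) renaming (_∈_ to _∈ˡ_)
open import Data.List.Membership.Propositional.Properties
  using (∈-map⁺; ∈-filter⁺; ∈-filter⁻; ∈-cartesianProduct⁺; ∈-allFin)
import Data.List.Relation.Unary.All as All
open import Data.List.Relation.Unary.Any using (Any; any?)
open import Data.Nat.Base as ℕ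
  using (ℕ; zero; suc; _+_; _*_; _∸_; _≤_; _<_; ∣_-_∣; z≤n; s≤s; NonZero)
open import Data.Nat.DivMod using (_/_; _%_; m≡m%n+[m/n]*n; m%n<n; m*n%n≡0)
import Data.Nat.Properties as ℕ
open import Data.Product.Base using (∃; _×_; _,_; proj₁; proj₂; uncurry)
open import Data.Rational.Base as ℚ using (ℚ; 1ℚ; toℚᵘ; fromℚᵘ)
import Data.Rational.Properties as ℚ
open import Data.Rational.Unnormalised.Base as ℚᵘ using (mkℚᵘ; 1ℚᵘ)
import Data.Rational.Unnormalised.Properties as ℚᵘ
open import Data.Sum.Base using (_⊎_; inj₁; inj₂)
open import Function.Base using (_∘_)
open import Function.Bundles using (_⇔_; mk⇔; module Equivalence; module Inverse; module Bijection)
open import Level using (0ℓ)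
open import Relation.Binary.Core using (Rel)
open import Relation.Binary.Definitions using (Decidable; tri<; tri≈; tri>)
open import Relation.Binary.PropositionalEquality
  using (_≡_; _≢_; refl; sym; trans; cong; cong₂; subst; subst₂; module ≡-Reasoning)
open import Relation.Nullary using (yes; no; ¬_; Dec; contradiction)
open import Relation.Nullary.Decidable using (_×-dec_; decidable-stable)

-- Rational numbers as cuts, and unit shifts of them

fromℚ : ℚ → ℝ
fromℚ x = record
  { Lower           = ℚ._< x
  ; Upper           = x ℚ.<_
  ; lower-inhabited = x ℚ.- 1ℚ ,
      subst (x ℚ.- 1ℚ ℚ.<_) (ℚ.+-identityʳ x) (ℚ.+-monoʳ-< x (ℚ.negative⁻¹ _))
  ; upper-inhabited = x ℚ.+ 1ℚ ,
      subst (ℚ._< x ℚ.+ 1ℚ) (ℚ.+-identityʳ x) (ℚ.+-monoʳ-< x (ℚ.positive⁻¹ _))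
  ; lower-closed    = ℚ.<-trans
  ; upper-closed    = λ p<q x<p → ℚ.<-trans x<p p<q
  ; lower-open      = ℚ.<-dense
  ; upper-open      = λ x<q → let p , x<p , p<q = ℚ.<-dense x<q in p , p<q , x<p
  ; disjoint        = ℚ.<-asym
  ; located         = λ {p} {q} p<q → locate p<q (p ℚ.<? x)
  }
  where
  locate : ∀ {p q} → p ℚ.< q → _ → _
  locate p<q (yes p<x) = inj₁ p<x
  locate p<q (no p≮x)  = inj₂ (ℚ.≤-<-trans (ℚ.≮⇒≥ p≮x) p<q)

p+1-1≡p : ∀ p → p ℚ.+ 1ℚ ℚ.- 1ℚ ≡ p
p+1-1≡p p = trans (ℚ.+-assoc p 1ℚ (ℚ.- 1ℚ)) (ℚ.+-identityʳ p)

fromℚ-mono-≤ : ∀ {p q} → p ℚ.≤ q → fromℚ p ≤ℝ fromℚ q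
fromℚ-mono-≤ p≤q _ r<p = ℚ.<-≤-trans r<p p≤q

≤+1⇒≤ℝ+1 : ∀ {p q} → p ℚ.≤ q ℚ.+ 1ℚ → fromℚ p ≤ℝ fromℚ q +1
≤+1⇒≤ℝ+1 {q = q} p≤q+1 r r<p =
  subst (r ℚ.- 1ℚ ℚ.<_) (p+1-1≡p q) (ℚ.+-monoˡ-< (ℚ.- 1ℚ) (ℚ.<-≤-trans r<p p≤q+1))

-- Otherwise `q + 1` would lie in the lower cut of `p`, hence in that of `fromℚ q +1`, which says
-- `q < q`.
≤ℝ+1⇒≤+1 : ∀ {p q} → fromℚ p ≤ℝ fromℚ q +1 → p ℚ.≤ q ℚ.+ 1ℚ
≤ℝ+1⇒≤+1 {q = q} p≤q+1 = ℚ.≮⇒≥ λ q+1<p →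
  ℚ.<-irrefl (p+1-1≡p q) (p≤q+1 (q ℚ.+ 1ℚ) q+1<p)

p≤p+1 : ∀ p → p ℚ.≤ p ℚ.+ 1ℚ
p≤p+1 p = subst (ℚ._≤ p ℚ.+ 1ℚ) (ℚ.+-identityʳ p) (ℚ.+-monoʳ-≤ p (ℚ.nonNegative⁻¹ 1ℚ))

-- Integer coordinates rescaled to unit length

ratio : ℤ → ℕ → ℚ
ratio m l = fromℚᵘ (mkℚᵘ m l)

module _ (m n : ℤ) (l : ℕ) where

  private
    L = + suc l

    ratio+1 : toℚᵘ (ratio n l ℚ.+ 1ℚ) ℚᵘ.≃ mkℚᵘ n l ℚᵘ.+ 1ℚᵘ
    ratio+1 = ℚᵘ.≃-trans (ℚ.toℚᵘ-homo-+ (ratio n l) 1ℚ)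
                         (ℚᵘ.+-congˡ 1ℚᵘ (ℚ.toℚᵘ-fromℚᵘ (mkℚᵘ n l)))

    -- The two sides of the inequality after cross-multiplication; the common factor `L` is positive
    -- and cancels.
    lhs : m ℤ.* (L ℤ.* + 1) ≡ m ℤ.* L
    lhs = cong (m ℤ.*_) (ℤ.*-identityʳ L)

    rhs : (n ℤ.* + 1 ℤ.+ + 1 ℤ.* L) ℤ.* L ≡ (n ℤ.+ L) ℤ.* L
    rhs = cong (ℤ._* L) (cong₂ ℤ._+_ (ℤ.*-identityʳ n) (ℤ.*-identityˡ L))

  ratio-≤+1⁺ : m ℤ.≤ n ℤ.+ L → ratio m l ℚ.≤ ratio n l ℚ.+ 1ℚ
  ratio-≤+1⁺ m≤n+L = ℚ.toℚᵘ-cancel-≤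
    (ℚᵘ.≤-respˡ-≃ (ℚᵘ.≃-sym (ℚ.toℚᵘ-fromℚᵘ (mkℚᵘ m l)))
    (ℚᵘ.≤-respʳ-≃ (ℚᵘ.≃-sym ratio+1)
    (ℚᵘ.*≤* (subst₂ ℤ._≤_ (sym lhs) (sym rhs) (ℤ.*-monoʳ-≤-nonNeg L m≤n+L)))))

  ratio-≤+1⁻ : ratio m l ℚ.≤ ratio n l ℚ.+ 1ℚ → m ℤ.≤ n ℤ.+ L
  ratio-≤+1⁻ r≤r+1 = ℤ.*-cancelʳ-≤-pos m (n ℤ.+ L) L
    (subst₂ ℤ._≤_ lhs rhs (ℚᵘ.drop-*≤*
    (ℚᵘ.≤-respˡ-≃ (ℚ.toℚᵘ-fromℚᵘ (mkℚᵘ m l))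
    (ℚᵘ.≤-respʳ-≃ ratio+1 (ℚ.toℚᵘ-mono-≤ r≤r+1)))))

i≤+∣i∣ : ∀ i → i ℤ.≤ + ℤ.∣ i ∣
i≤+∣i∣ (+ n)      = ℤ.≤-refl
i≤+∣i∣ ℤ.-[1+ n ] = ℤ.-≤+

∣i-j∣≤k⇒i≤j+k : ∀ i j {k} → ℤ.∣ i ℤ.- j ∣ ≤ k → i ℤ.≤ j ℤ.+ + k
∣i-j∣≤k⇒i≤j+k i j {k} d≤k = subst (ℤ._≤ j ℤ.+ + k) (cancel i j)
  (ℤ.+-monoʳ-≤ j (ℤ.≤-trans (i≤+∣i∣ (i ℤ.- j)) (ℤ.+≤+ d≤k)))
  where
  cancel : ∀ i j → j ℤ.+ (i ℤ.- j) ≡ i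
  cancel = solve-∀

≤k∧-≤k⇒∣∣≤k : ∀ i {k} → i ℤ.≤ + k → ℤ.- i ℤ.≤ + k → ℤ.∣ i ∣ ≤ k
≤k∧-≤k⇒∣∣≤k i i≤k -i≤k with ℤ.+∣i∣≡i⊎+∣i∣≡-i i
... | inj₁ eq = ℤ.drop‿+≤+ (subst (ℤ._≤ _) (sym eq) i≤k)
... | inj₂ eq = ℤ.drop‿+≤+ (subst (ℤ._≤ _) (sym eq) -i≤k)

i≤j+k∧j≤i+k⇒∣i-j∣≤k : ∀ i j {k} → i ℤ.≤ j ℤ.+ + k → j ℤ.≤ i ℤ.+ + k → ℤ.∣ i ℤ.- j ∣ ≤ k
i≤j+k∧j≤i+k⇒∣i-j∣≤k i j {k} i≤ j≤ = ≤k∧-≤k⇒∣∣≤k (i ℤ.- j)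
  (subst (i ℤ.- j ℤ.≤_) (i+k-i≡k j (+ k)) (ℤ.+-monoˡ-≤ (ℤ.- j) i≤))
  (subst₂ ℤ._≤_ (j-i≡-[i-j] i j) (i+k-i≡k i (+ k)) (ℤ.+-monoˡ-≤ (ℤ.- i) j≤))
  where
  i+k-i≡k : ∀ j k → j ℤ.+ k ℤ.- j ≡ k
  i+k-i≡k = solve-∀
  j-i≡-[i-j] : ∀ i j → j ℤ.- i ≡ ℤ.- (i ℤ.- j)
  j-i≡-[i-j] = solve-∀

ratio-close⁺ : ∀ m n l → ℤ.∣ m ℤ.- n ∣ ≤ suc l →
  ratio m l ℚ.≤ ratio n l ℚ.+ 1ℚ × ratio n l ℚ.≤ ratio m l ℚ.+ 1ℚ
ratio-close⁺ m n l d≤1+l =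
    ratio-≤+1⁺ m n l (∣i-j∣≤k⇒i≤j+k m n d≤1+l)
  , ratio-≤+1⁺ n m l (∣i-j∣≤k⇒i≤j+k n m (subst (_≤ suc l) (ℤ.∣i-j∣≡∣j-i∣ m n) d≤1+l))

ratio-close⁻ : ∀ m n l →
  ratio m l ℚ.≤ ratio n l ℚ.+ 1ℚ × ratio n l ℚ.≤ ratio m l ℚ.+ 1ℚ →
  ℤ.∣ m ℤ.- n ∣ ≤ suc l
ratio-close⁻ m n l (m≤n+1 , n≤m+1) =
  i≤j+k∧j≤i+k⇒∣i-j∣≤k m n (ratio-≤+1⁻ m n l m≤n+1) (ratio-≤+1⁻ n m l n≤m+1)

-- Intersection of cubes with rational corners

intersect⁺ : ∀ {k} (a c : Fin k → ℚ) →
  (∀ i → a i ℚ.≤ c i ℚ.+ 1ℚ × c i ℚ.≤ a i ℚ.+ 1ℚ) →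
  Intersect (λ i → fromℚ (a i)) (λ i → fromℚ (c i))
-- In each coordinate the larger left endpoint is a common point.
intersect⁺ a c a~c = (λ i → fromℚ (a i ℚ.⊔ c i))
  , (λ i → fromℚ-mono-≤ (ℚ.p≤p⊔q (a i) (c i))
         , ≤+1⇒≤ℝ+1 (ℚ.⊔-lub (p≤p+1 (a i)) (proj₂ (a~c i))))
  , (λ i → fromℚ-mono-≤ (ℚ.p≤q⊔p (a i) (c i))
         , ≤+1⇒≤ℝ+1 (ℚ.⊔-lub (proj₁ (a~c i)) (p≤p+1 (c i))))

intersect⁻ : ∀ {k} (a c : Fin k → ℚ) →
  Intersect (λ i → fromℚ (a i)) (λ i → fromℚ (c i)) →
  ∀ i → a i ℚ.≤ c i ℚ.+ 1ℚ × c i ℚ.≤ a i ℚ.+ 1ℚ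
intersect⁻ a c (x , x∈a , x∈c) i =
    ≤ℝ+1⇒≤+1 (λ q q<a → proj₂ (x∈c i) q (proj₁ (x∈a i) q q<a))
  , ≤ℝ+1⇒≤+1 (λ q q<c → proj₂ (x∈a i) q (proj₁ (x∈c i) q q<c))

-- Blocks of nearby positions

divMod-next : ∀ {b o o′} q q′ → o < b → o′ < b →
  o + q * b < o′ + q′ * b → o′ + q′ * b ≤ o + q * b + b →
  (q′ ≡ q × o < o′) ⊎ (q′ ≡ suc q × o′ ≤ o)
-- If `q′ < q`, the second number would be below `q * b`; if `q′ ≥ q + 2`, a whole block would lie
-- in between and the gap would exceed `b`.
divMod-next {b} {o} {o′} q q′ o<b o′<b lt le with ℕ.<-cmp q′ q
... | tri< q′<q _ _ = contradiction lt (ℕ.<⇒≯ (begin-strict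
  o′ + q′ * b <⟨ ℕ.+-monoˡ-< (q′ * b) o′<b ⟩
  suc q′ * b  ≤⟨ ℕ.*-monoˡ-≤ b q′<q ⟩
  q * b       ≤⟨ ℕ.m≤n+m (q * b) o ⟩
  o + q * b   ∎))
  where open ℕ.≤-Reasoning
... | tri≈ _ refl _ = inj₁ (refl , ℕ.+-cancelʳ-< (q * b) o o′ lt)
... | tri> _ _ q<q′ with ℕ.m≤n⇒m<n∨m≡n q<q′
...   | inj₂ refl = inj₂ (refl , ℕ.+-cancelʳ-≤ (b + q * b) o′ o (begin
  o′ + (b + q * b) ≤⟨ le ⟩
  o + q * b + b    ≡⟨ ℕ.+-assoc o (q * b) b ⟩
  o + (q * b + b)  ≡⟨ cong (_+_ o) (ℕ.+-comm (q * b) b) ⟩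
  o + (b + q * b)  ∎))
  where open ℕ.≤-Reasoning
...   | inj₁ 2+q≤q′ = contradiction le (ℕ.<⇒≱ (begin-strict
  o + q * b + b   <⟨ ℕ.+-monoˡ-< b (ℕ.+-monoˡ-< (q * b) o<b) ⟩
  b + q * b + b   ≡⟨ ℕ.+-comm (b + q * b) b ⟩
  suc (suc q) * b ≤⟨ ℕ.*-monoˡ-≤ b 2+q≤q′ ⟩
  q′ * b          ≤⟨ ℕ.m≤n+m (q′ * b) o′ ⟩
  o′ + q′ * b     ∎))
  where open ℕ.≤-Reasoning

-- One coordinate, block by block

module Walk (b : ℕ) .{{_ : NonZero b}} {_~_ : Rel ℕ 0ℓ} (_~?_ : Decidable _~_) where

  near : ∀ {i j} → Dec (i ~ j) → ℤ
  near (yes _) = + 2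
  near (no _)  = + 3

  step turn : ∀ {i j} → Dec (i ~ j) → ℤ
  step (yes _) = + 1
  step (no _)  = + 4
  turn (yes _) = + 1
  turn (no _)  = ℤ.- + 1

  link : ∀ q → Dec ((q * b) ~ (suc q * b))
  link q = (q * b) ~? (suc q * b)

  direction : ℕ → ℤ
  direction zero    = + 1
  direction (suc q) = direction q ℤ.* turn (link q)

  centre : ℕ → ℤ
  centre zero    = + 0
  centre (suc q) = centre q ℤ.+ direction q ℤ.* step (link q)

  offset : ℕ → ℕ → ℤ
  offset q zero    = + 0
  offset q (suc o) = near ((q * b) ~? (suc o + q * b))

  height : ℕ → ℕ → ℤ
  height q o = centre q ℤ.+ direction q ℤ.* offset q o

  ∣direction∣≡1 : ∀ q → ℤ.∣ direction q ∣ ≡ 1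
  ∣direction∣≡1 zero    = refl
  ∣direction∣≡1 (suc q) = trans (ℤ.abs-* (direction q) (turn (link q)))
    (cong₂ _*_ (∣direction∣≡1 q) (∣turn∣≡1 (link q)))
    where
    ∣turn∣≡1 : ∀ {i j} (d : Dec (i ~ j)) → ℤ.∣ turn d ∣ ≡ 1
    ∣turn∣≡1 (yes _) = refl
    ∣turn∣≡1 (no _)  = refl

  ∣direction*∣ : ∀ q d → ℤ.∣ direction q ℤ.* d ∣ ≡ ℤ.∣ d ∣
  ∣direction*∣ q d = trans (ℤ.abs-* (direction q) d)
    (trans (cong (_* ℤ.∣ d ∣) (∣direction∣≡1 q)) (ℕ.*-identityˡ ℤ.∣ d ∣))

  -- The common centre cancels, and the direction has absolute value 1.
  same-block : ∀ q o o′ → ℤ.∣ height q o′ ℤ.- height q o ∣ ≡ ℤ.∣ offset q o′ ℤ.- offset q o ∣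
  same-block q o o′ = trans
    (cong ℤ.∣_∣ (factor (centre q) (direction q) (offset q o) (offset q o′)))
    (∣direction*∣ q _)
    where
    factor : ∀ c s x y → (c ℤ.+ s ℤ.* y) ℤ.- (c ℤ.+ s ℤ.* x) ≡ s ℤ.* (y ℤ.- x)
    factor = solve-∀

  -- Seen from the centre of block `q` along its direction, the next centre is at `step` and the
  -- next direction is `turn`. What remains takes finitely many values.
  next-block : ∀ q o o′ → ℤ.∣ height (suc q) o′ ℤ.- height q o ∣ ≡
    ℤ.∣ step (link q) ℤ.+ turn (link q) ℤ.* offset (suc q) o′ ℤ.- offset q o ∣
  next-block q o o′ = trans
    (cong ℤ.∣_∣ (factor (centre q) (direction q) (step (link q)) (turn (link q))
      (offset q o) (offset (suc q) o′)))
    (∣direction*∣ q _)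
    where
    factor : ∀ c s e t x y → (c ℤ.+ s ℤ.* e ℤ.+ s ℤ.* t ℤ.* y) ℤ.- (c ℤ.+ s ℤ.* x) ≡
      s ℤ.* (e ℤ.+ t ℤ.* y ℤ.- x)
    factor = solve-∀

  -- An edge at the centre has offset difference 2; any other two offsets are 2 or 3.
  same-block-close : ∀ q {o o′} → o < o′ → (o + q * b) ~ (o′ + q * b) →
    ℤ.∣ offset q o′ ℤ.- offset q o ∣ ≤ 2
  same-block-close q {zero} {suc o′} _ edge with (q * b) ~? (suc o′ + q * b)
  ... | yes _ = ℕ.≤-refl
  ... | no ¬e = contradiction edge ¬e
  same-block-close q {suc o} {suc o′} _ _
    with (q * b) ~? (suc o + q * b) | (q * b) ~? (suc o′ + q * b)
  ... | yes _ | yes _ = z≤n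
  ... | yes _ | no _  = s≤s z≤n
  ... | no _  | yes _ = s≤s z≤n
  ... | no _  | no _  = z≤n

  -- Relative to block `q`, the next block has its centre at 1 and the rest at 3 or 4 if the centres
  -- are linked, and its centre at 4 and the rest at 2 or 1 if not. All these are within 2 of the
  -- offsets 2 and 3. As `o′ ≤ o`, the centre of block `q`, at 0, is compared only with the next
  -- centre, which an edge puts at 1.
  next-block-close : ∀ q {o o′} → o′ ≤ o → (o + q * b) ~ (o′ + suc q * b) →
    ℤ.∣ step (link q) ℤ.+ turn (link q) ℤ.* offset (suc q) o′ ℤ.- offset q o ∣ ≤ 2
  next-block-close q {zero} {zero} _ edge with link q
  ... | yes _ = s≤s z≤n
  ... | no ¬e = contradiction edge ¬e
  next-block-close q {suc o} {zero} _ _ with link q | (q * b) ~? (suc o + q * b)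
  ... | yes _ | yes _ = s≤s z≤n
  ... | yes _ | no _  = ℕ.≤-refl
  ... | no _  | yes _ = ℕ.≤-refl
  ... | no _  | no _  = s≤s z≤n
  next-block-close q {suc o} {suc o′} _ _
    with link q | (q * b) ~? (suc o + q * b) | (suc q * b) ~? (suc o′ + suc q * b)
  ... | yes _ | yes _ | yes _ = s≤s z≤n
  ... | yes _ | yes _ | no _  = ℕ.≤-refl
  ... | yes _ | no _  | yes _ = z≤n
  ... | yes _ | no _  | no _  = s≤s z≤n
  ... | no _  | yes _ | yes _ = z≤n
  ... | no _  | yes _ | no _  = s≤s z≤n
  ... | no _  | no _  | yes _ = s≤s z≤n
  ... | no _  | no _  | no _  = ℕ.≤-refl

  height-close : ∀ {q o q′ o′} → (q′ ≡ q × o < o′) ⊎ (q′ ≡ suc q × o′ ≤ o) →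
    (o + q * b) ~ (o′ + q′ * b) → ℤ.∣ height q′ o′ ℤ.- height q o ∣ ≤ 2
  height-close {q} {o} {_} {o′} (inj₁ (refl , o<o′)) e =
    subst (_≤ 2) (sym (same-block q o o′)) (same-block-close q o<o′ e)
  height-close {q} {o} {_} {o′} (inj₂ (refl , o′≤o)) e =
    subst (_≤ 2) (sym (next-block q o o′)) (next-block-close q o′≤o e)

  centre-apart : ∀ q o → ¬ ((q * b) ~ (suc o + q * b)) → 2 < ℤ.∣ offset q (suc o) ℤ.- + 0 ∣
  centre-apart q o ¬e with (q * b) ~? (suc o + q * b)
  ... | yes e = contradiction e ¬e
  ... | no _  = ℕ.≤-refl

  centres-apart : ∀ q → ¬ ((q * b) ~ (suc q * b)) →
    2 < ℤ.∣ step (link q) ℤ.+ turn (link q) ℤ.* + 0 ℤ.- + 0 ∣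
  centres-apart q ¬e with link q
  ... | yes e = contradiction e ¬e
  ... | no _  = s≤s (s≤s (s≤s z≤n))

  height-apart : ∀ {q o q′ o′} → o ≡ 0 → (q′ ≡ q × o < o′) ⊎ (q′ ≡ suc q × o′ ≤ o) →
    ¬ ((o + q * b) ~ (o′ + q′ * b)) → 2 < ℤ.∣ height q′ o′ ℤ.- height q o ∣
  height-apart {q} {o′ = suc o′} refl (inj₁ (refl , _)) ¬e =
    subst (2 <_) (sym (same-block q 0 (suc o′))) (centre-apart q o′ ¬e)
  -- Here `o′ ≤ 0`, so the right member is the next centre, at distance exactly `b`.
  height-apart {q} {o′ = zero} refl (inj₂ (refl , _)) ¬e =
    subst (2 <_) (sym (next-block q 0 0)) (centres-apart q ¬e)

  walk : ℕ → ℤ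
  walk i = height (i / b) (i % b)

  locate : ∀ {i j} → i < j → j ≤ i + b →
    (j / b ≡ i / b × i % b < j % b) ⊎ (j / b ≡ suc (i / b) × j % b ≤ i % b)
  locate {i} {j} i<j j≤i+b = divMod-next (i / b) (j / b) (m%n<n i b) (m%n<n j b)
    (subst₂ _<_ (m≡m%n+[m/n]*n i b) (m≡m%n+[m/n]*n j b) i<j)
    (subst₂ (λ i j → j ≤ i + b) (m≡m%n+[m/n]*n i b) (m≡m%n+[m/n]*n j b) j≤i+b)

  walk-close : ∀ {i j} → i < j → j ≤ i + b → i ~ j → ℤ.∣ walk j ℤ.- walk i ∣ ≤ 2
  walk-close {i} {j} i<j j≤i+b i~j = height-close (locate i<j j≤i+b)
    (subst₂ _~_ (m≡m%n+[m/n]*n i b) (m≡m%n+[m/n]*n j b) i~j)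

  walk-apart : ∀ {i j} → i % b ≡ 0 → i < j → j ≤ i + b → ¬ (i ~ j) → 2 < ℤ.∣ walk j ℤ.- walk i ∣
  walk-apart {i} {j} i%b≡0 i<j j≤i+b i≁j = height-apart i%b≡0 (locate i<j j≤i+b)
    λ e → i≁j (subst₂ _~_ (sym (m≡m%n+[m/n]*n i b)) (sym (m≡m%n+[m/n]*n j b)) e)

-- The b + 1 coordinates of a position

module Coordinates (b : ℕ) {_~_ : Rel ℕ 0ℓ} (_~?_ : Decidable _~_) where

  -- The shift by r + 1 makes the positions congruent to - (r + 1) modulo b the
  -- centres; ∸ is exact on the arguments that matter, as they are at least r + 1.
  module Shifted (r : Fin b) =
    Walk b {{nonZeroIndex r}} (λ i j → (i ∸ suc (toℕ r)) ~? (j ∸ suc (toℕ r)))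

  -- Doubling the position turns the unit b + 1/2 into the integer 2b + 1, which is positive even
  -- for b = 0.
  coordinate : Fin (suc b) → ℕ → ℤ
  coordinate zero    i = + (2 * i)
  coordinate (suc r) i = Shifted.walk r (i + suc (toℕ r))

  -- The unit length of coordinate d is suc (scale d).
  scale : Fin (suc b) → ℕ
  scale zero    = 2 * b
  scale (suc _) = 1

  Close : Rel ℕ 0ℓ
  Close i j = ∀ d → ℤ.∣ coordinate d i ℤ.- coordinate d j ∣ ≤ suc (scale d)

  Close-sym : ∀ {i j} → Close i j → Close j i
  Close-sym {i} {j} i≈j d =
    subst (_≤ suc (scale d)) (ℤ.∣i-j∣≡∣j-i∣ (coordinate d i) (coordinate d j)) (i≈j d)

  ∣2j-2i∣≡2[j∸i] : ∀ {i j} → i ≤ j → ℤ.∣ + (2 * j) ℤ.- + (2 * i) ∣ ≡ 2 * (j ∸ i)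
  ∣2j-2i∣≡2[j∸i] {i} {j} i≤j = begin
    ℤ.∣ + (2 * j) ℤ.- + (2 * i) ∣ ≡⟨ ℤ.∣i-j∣≡∣j-i∣ (+ (2 * j)) (+ (2 * i)) ⟩
    ℤ.∣ + (2 * i) ℤ.- + (2 * j) ∣ ≡⟨ cong ℤ.∣_∣ (ℤ.[+m]-[+n]≡m⊖n (2 * i) (2 * j)) ⟩
    ℤ.∣ (2 * i) ℤ.⊖ (2 * j) ∣     ≡⟨ ℤ.∣⊖∣-≤ (ℕ.*-monoʳ-≤ 2 i≤j) ⟩
    2 * j ∸ 2 * i                 ≡⟨ ℕ.*-distribˡ-∸ 2 j i ⟨
    2 * (j ∸ i)                   ∎
    where open ≡-Reasoning

  shift-≤ : ∀ {i j} k → j ≤ i + b → j + k ≤ i + k + b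
  shift-≤ {i} {j} k j≤i+b = begin
    j + k       ≤⟨ ℕ.+-monoˡ-≤ k j≤i+b ⟩
    i + b + k   ≡⟨ ℕ.+-assoc i b k ⟩
    i + (b + k) ≡⟨ cong (_+_ i) (ℕ.+-comm b k) ⟩
    i + (k + b) ≡⟨ ℕ.+-assoc i k b ⟨
    i + k + b   ∎
    where open ℕ.≤-Reasoning

  unshift : ∀ {i j} k → (i + k ∸ k) ~ (j + k ∸ k) ⇔ i ~ j
  unshift {i} {j} k = mk⇔
    (subst₂ _~_ (ℕ.m+n∸n≡m i k) (ℕ.m+n∸n≡m j k))
    (subst₂ _~_ (sym (ℕ.m+n∸n≡m i k)) (sym (ℕ.m+n∸n≡m j k)))

  related⇒Close : ∀ {i j} → i < j → j ≤ i + b → i ~ j → Close j i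
  related⇒Close {i} {j} i<j j≤i+b i~j zero = begin
    ℤ.∣ + (2 * j) ℤ.- + (2 * i) ∣ ≡⟨ ∣2j-2i∣≡2[j∸i] (ℕ.<⇒≤ i<j) ⟩
    2 * (j ∸ i)                   ≤⟨ ℕ.*-monoʳ-≤ 2 (ℕ.m≤n+o⇒m∸n≤o j i j≤i+b) ⟩
    2 * b                         ≤⟨ ℕ.n≤1+n (2 * b) ⟩
    suc (2 * b)                   ∎
    where open ℕ.≤-Reasoning
  related⇒Close {i} {j} i<j j≤i+b i~j (suc r) =
    Shifted.walk-close r (ℕ.+-monoˡ-< k i<j) (shift-≤ k j≤i+b) (Equivalence.from (unshift k) i~j)
    where k = suc (toℕ r)

  -- The class of centres that contains i.
  phase : ∀ .{{_ : NonZero b}} i → ∃ λ (r : Fin b) → (i + suc (toℕ r)) % b ≡ 0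
  phase i = r , trans (cong (_% b) i+1+r≡[1+q]*b) (m*n%n≡0 (suc q) b)
    where
    open ≡-Reasoning
    o = i % b
    q = i / b
    -- This is b - 1 - o, so that the shift by `r + 1` takes `i` to the next larger multiple of `b`.
    r = opposite (fromℕ< (m%n<n i b))

    toℕ-r : toℕ r ≡ b ∸ suc o
    toℕ-r = trans (opposite-prop (fromℕ< (m%n<n i b)))
                  (cong (λ x → b ∸ suc x) (toℕ-fromℕ< (m%n<n i b)))

    i+1+r≡[1+q]*b : i + suc (toℕ r) ≡ suc q * b
    i+1+r≡[1+q]*b = begin
      i + suc (toℕ r)               ≡⟨ cong₂ (λ x y → x + suc y) (m≡m%n+[m/n]*n i b) toℕ-r ⟩
      o + q * b + suc (b ∸ suc o)   ≡⟨ cong (_+ suc (b ∸ suc o)) (ℕ.+-comm o (q * b)) ⟩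
      q * b + o + suc (b ∸ suc o)   ≡⟨ ℕ.+-assoc (q * b) o _ ⟩
      q * b + (o + suc (b ∸ suc o)) ≡⟨ cong (_+_ (q * b)) (ℕ.+-suc o (b ∸ suc o)) ⟩
      q * b + (suc o + (b ∸ suc o)) ≡⟨ cong (_+_ (q * b)) (ℕ.m+[n∸m]≡n (m%n<n i b)) ⟩
      q * b + b                     ≡⟨ ℕ.+-comm (q * b) b ⟩
      suc q * b                     ∎

  unrelated⇒¬Close : ∀ {i j} → i < j → ¬ i ~ j → ¬ Close j i
  unrelated⇒¬Close {i} {j} i<j i≁j j≈i with j ℕ.≤? i + b
  ... | no j≰i+b = ℕ.<⇒≱ far (j≈i zero)
    where
    open ℕ.≤-Reasoning
    far : suc (2 * b) < ℤ.∣ + (2 * j) ℤ.- + (2 * i) ∣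
    far = begin-strict
      suc (2 * b)                   <⟨ ℕ.n<1+n _ ⟩
      2 + 2 * b                     ≡⟨ ℕ.*-suc 2 b ⟨
      2 * suc b                     ≤⟨ ℕ.*-monoʳ-≤ 2 (ℕ.m+n≤o⇒m≤o∸n (suc b)
                                       (subst (_< j) (ℕ.+-comm i b) (ℕ.≰⇒> j≰i+b))) ⟩
      2 * (j ∸ i)                   ≡⟨ ∣2j-2i∣≡2[j∸i] (ℕ.<⇒≤ i<j) ⟨
      ℤ.∣ + (2 * j) ℤ.- + (2 * i) ∣ ∎
  ... | yes j≤i+b = ℕ.<⇒≱ apart (j≈i (suc r))
    where
    -- Residue classes modulo `b` require `b` to be positive, which `i < j ≤ i + b` ensures.
    b≢0 : b ≢ 0
    b≢0 refl = ℕ.<⇒≱ i<j (subst (j ≤_) (ℕ.+-identityʳ i) j≤i+b)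

    r = proj₁ (phase {{ℕ.≢-nonZero b≢0}} i)
    k = suc (toℕ r)

    apart : 2 < ℤ.∣ coordinate (suc r) j ℤ.- coordinate (suc r) i ∣
    apart = Shifted.walk-apart r (proj₂ (phase {{ℕ.≢-nonZero b≢0}} i))
      (ℕ.+-monoˡ-< k i<j) (shift-≤ k j≤i+b) (i≁j ∘ Equivalence.to (unshift k))

-- From positions back to the vertices of the graph

module _ (G : Graph) where
  open Graph G

  ∈-vertices : ∀ v → v ∈ˡ vertices
  ∈-vertices v = subst (_∈ˡ vertices) (Inverse.strictlyInverseʳ finite v)
    (∈-map⁺ (Inverse.from finite) (∈-allFin (Inverse.to finite v)))

  ∈-edges : ∀ {u v} → Adj u v → (u , v) ∈ˡ edges
  ∈-edges {u} {v} =
    ∈-filter⁺ (uncurry adj?) {xs = cartesianProduct vertices vertices}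
      (∈-cartesianProduct⁺ (∈-vertices u) (∈-vertices v))

  module _ (f : LinearOrdering G) where

    position : Vertex → ℕ
    position v = toℕ (Bijection.to f v)

    position-injective : ∀ {u v} → position u ≡ position v → u ≡ v
    position-injective = Bijection.injective f ∘ toℕ-injective

    adjacent⇒≤width : ∀ {u v} → Adj u v → ∣ position u - position v ∣ ≤ width G f
    adjacent⇒≤width uv = All.lookup (xs≤max 0 _) (∈-map⁺ _ (∈-edges uv))

    -- Adjacency carried over to positions. The search through the finite list `edges` makes it
    -- decidable on all of ℕ, also at numbers that are no position.
    Joined : Rel ℕ 0ℓ
    Joined i j = Any (λ (u , v) → position u ≡ i × position v ≡ j) edges

    joined? : Decidable Joined
    joined? i j = any? (λ (u , v) → (position u ℕ.≟ i) ×-dec (position v ℕ.≟ j)) edges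

    adjacent⇒Joined : ∀ {u v} → Adj u v → Joined (position u) (position v)
    adjacent⇒Joined uv = lose (∈-edges uv) (refl , refl)

    Joined⇒adjacent : ∀ {u v} → Joined (position u) (position v) → Adj u v
    Joined⇒adjacent joined =
      let _ , e∈edges , pu , pv = find joined
      in subst₂ Adj (position-injective pu) (position-injective pv)
           (proj₂ (∈-filter⁻ (uncurry adj?)
             {xs = cartesianProduct vertices vertices} e∈edges))

    open Coordinates (width G f) joined?

    at : Vertex → Fin (suc (width G f)) → ℤ
    at v d = coordinate d (position v)

    point : Vertex → Fin (suc (width G f)) → ℚ
    point v d = ratio (at v d) (scale d)

    adjacent⇒Close : ∀ {u v} → position u < position v → Adj u v → Close (position v) (position u)
    adjacent⇒Close {u} {v} u<v uv = related⇒Close u<v v≤u+w (adjacent⇒Joined uv)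
      where
      v≤u+w : position v ≤ position u + width G f
      v≤u+w = ℕ.≤-trans (ℕ.m≤n+∣n-m∣ (position v) (position u))
                        (ℕ.+-monoʳ-≤ (position u) (adjacent⇒≤width uv))

    adjacent⇔Close : ∀ {u v} → u ≢ v → Adj u v ⇔ Close (position u) (position v)
    adjacent⇔Close {u} {v} u≢v with ℕ.<-cmp (position u) (position v)
    ... | tri≈ _ u≡v _ = contradiction (position-injective u≡v) u≢v
    -- The converse goes by contradiction, as adjacency is decidable.
    ... | tri< u<v _ _ = mk⇔ (Close-sym ∘ adjacent⇒Close u<v) λ u≈v →
      decidable-stable (adj? u v) λ ¬uv →
        unrelated⇒¬Close u<v (¬uv ∘ Joined⇒adjacent) (Close-sym u≈v)
    ... | tri> _ _ v<u = mk⇔ (adjacent⇒Close v<u ∘ symm) λ u≈v →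
      decidable-stable (adj? u v) λ ¬uv →
        unrelated⇒¬Close v<u (¬uv ∘ symm ∘ Joined⇒adjacent) u≈v

    width+1-representable : CubeRepresentable G (suc (width G f))
    width+1-representable = (λ v → fromℚ ∘ point v) , λ u v u≢v → mk⇔
      (λ uv → intersect⁺ (point u) (point v) λ d →
        ratio-close⁺ (at u d) (at v d) (scale d)
          (Equivalence.to (adjacent⇔Close u≢v) uv d))
      (λ meet → Equivalence.from (adjacent⇔Close u≢v) λ d →
        ratio-close⁻ (at u d) (at v d) (scale d)
          (intersect⁻ (point u) (point v) meet d))

theorem2 : (G : Graph) (b : ℕ) → IsBandwidth G b →
    (∃ λ k → k ≤ b + 1 × CubeRepresentable G k) ×
    (∀ c → IsCubicity G c → c ≤ b + 1)
-- Matching on `refl` makes `b` the width of an optimal ordering `f`.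
theorem2 G _ ((f , refl) , _) =
    (suc (width G f) , 1+w≤w+1 , width+1-representable G f)
  , λ _ (_ , least) → ℕ.≤-trans (least _ (width+1-representable G f)) 1+w≤w+1
  where
  1+w≤w+1 : suc (width G f) ≤ width G f + 1
  1+w≤w+1 = ℕ.≤-reflexive (ℕ.+-comm 1 (width G f))
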